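{- Let $k \geq 1$ and $t \geq k+1$ be integers such that $2^t - 2^k - 1$ is prime. Then $n = 2^{t-1}(2^t - 2^k - 1)$ is a near-perfect number with redundant divisor $2^k$.
   Context: A proper divisor of a positive integer $n$ is a positive divisor of $n$ different from $n$. A positive integer $n$ is called near-perfect if it is the sum of all its proper divisors except for exactly one of them, $d = d(n)$; this divisor $d$ is called the redundant divisor of $n$. Equivalently, $n$ is near-perfect with redundant divisor $d$ if $d$ is a proper divisor of $n$ and $\sigma(n) - 2n = d$, where $\sigma(n)$ denotes the sum of all positive divisors of $n$. -}

module Defs where

open import Data.List.Base using (List; applyUpTo; filter)
open import Data.List.Membership.Propositional using (_∈_)
open import Data.Nat.Base using (ℕ; suc; NonZero)
open import Data.Nat.Divisibility using (_∣?_)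
open import Data.Nat.ListAction using (sum)
open import Data.Nat.Properties using (_≟_)
open import Relation.Binary.PropositionalEquality using (_≡_)
open import Relation.Nullary.Decidable using (¬?)

-- The candidates are 1, …, n, so every entry is positive and occurs once.
-- For n = 0 the list is empty.
divisors : ℕ → List ℕ
divisors n = filter (_∣? n) (applyUpTo suc n)

properDivisors : ℕ → List ℕ
properDivisors n = filter (λ e → ¬? (e ≟ n)) (divisors n)

record NearPerfectWithRedundantDivisor (n d : ℕ) : Set where
  field
    nonZero         : NonZero n
    properDivisor   : d ∈ properDivisors n
    sumOfTheOthers  : n ≡ sum (filter (λ e → ¬? (e ≟ d)) (properDivisors n))

{-# OPTIONS --safe #-}
-- If p is an odd prime, the divisors of n = 2^s p are the 2^i and the p 2^i with i ≤ s, so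
-- σ(n) = (2^(s+1) − 1)(1 + p).  With 2^(s+1) = p + 1 + 2^k this equals
-- (p + 2^k)(1 + p) = p 2^(s+1) + 2^k = 2n + 2^k.
module Submission where

open import Defs
open import Data.Nat using (ℕ; zero; suc; _+_; _*_; _∸_; _^_; _≥_; _≤_; _<_; s≤s; s≤s⁻¹; NonZero; ≢-nonZero; ≢-nonZero⁻¹)
open import Data.Nat.Primality
  using (Prime; euclidsLemma; prime⇒nonZero; prime[2]; ¬prime[0]; ¬prime[1])
open import Data.List.Base using (List; []; _∷_; _++_; _∷ʳ_; map; filter; applyUpTo)
open import Data.List.Properties using (applyUpTo-∷ʳ)
open import Data.List.Membership.Propositional using (_∈_)
open import Data.List.Membership.Propositional.Properties
  using (∈-applyUpTo⁺; ∈-applyUpTo⁻; ∈-filter⁺; ∈-filter⁻; ∈-map⁺; ∈-map⁻; ∈-++⁺ˡ; ∈-++⁺ʳ; ∈-++⁻)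
open import Data.List.Membership.Propositional.Properties.WithK using (unique∧set⇒bag)
open import Data.List.Relation.Binary.BagAndSetEquality using (∼bag⇒↭)
open import Data.List.Relation.Binary.Permutation.Propositional using (_↭_)
import Data.List.Relation.Unary.All as All
open import Data.List.Relation.Unary.AllPairs using (_∷_)
open import Data.List.Relation.Unary.Any using (here; there)
open import Data.List.Relation.Unary.Unique.Propositional using (Unique)
import Data.List.Relation.Unary.Unique.Propositional.Properties as Unique
open import Data.Nat.Divisibility
open import Data.Nat.ListAction using (sum)
open import Data.Nat.ListAction.Properties using (sum-++; sum-↭)
open import Data.Nat.Properties
open import Data.Nat.Tactic.RingSolver using (solve)
open import Data.Product using (∃; _×_; _,_; proj₁; proj₂)
open import Data.Sum using (_⊎_; inj₁; inj₂)
open import Function using (_∘_; mk⇔)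
open import Relation.Binary.PropositionalEquality
open import Relation.Nullary using (¬_; yes; no; contradiction)
open import Relation.Nullary.Decidable using (¬?)

-- Membership in a repetition-free list has at most one proof, so here equality as sets is already
-- equality as bags, that is, up to permutation.
unique∧⊆∧⊇⇒↭ : ∀ {a} {A : Set a} {xs ys : List A} → Unique xs → Unique ys →
               (∀ {x} → x ∈ xs → x ∈ ys) → (∀ {x} → x ∈ ys → x ∈ xs) → xs ↭ ys
unique∧⊆∧⊇⇒↭ xs! ys! ⊆ ⊇ = ∼bag⇒↭ (unique∧set⇒bag xs! ys! (mk⇔ ⊆ ⊇))

-- Serves to split one summand off a sum: first `n` from its divisors, then `d` from the proper
-- divisors.
∈⇒↭∷filter : ∀ {x xs} → Unique xs → x ∈ xs → xs ↭ x ∷ filter (λ e → ¬? (e ≟ x)) xs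
∈⇒↭∷filter {x} {xs} xs! x∈xs =
  unique∧⊆∧⊇⇒↭ xs! (All.tabulate (λ e∈ x≡e → proj₂ (∈-filter⁻ ≢x? {xs = xs} e∈) (sym x≡e))
                     ∷ Unique.filter⁺ ≢x? xs!) to from
  where
  ≢x? = λ e → ¬? (e ≟ x)

  to : ∀ {e} → e ∈ xs → e ∈ x ∷ filter ≢x? xs
  to {e} e∈ with e ≟ x
  ... | yes refl = here refl
  ... | no  e≢x  = there (∈-filter⁺ ≢x? e∈ e≢x)

  from : ∀ {e} → e ∈ x ∷ filter ≢x? xs → e ∈ xs
  from (here refl) = x∈xs
  from (there e∈)  = proj₁ (∈-filter⁻ ≢x? e∈)

sum-map-* : ∀ c xs → sum (map (c *_) xs) ≡ c * sum xs
sum-map-* c []  = sym (*-zeroʳ c)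
sum-map-* c (x ∷ xs) = trans (cong (c * x +_) (sum-map-* c xs)) (sym (*-distribˡ-+ c x (sum xs)))

divisors-! : ∀ n → Unique (divisors n)
divisors-! n = Unique.filter⁺ (_∣? n) (Unique.applyUpTo⁺₁ suc n (λ i<j _ → <⇒≢ i<j ∘ suc-injective))

∣⇒∈divisors : ∀ {d n} .{{_ : NonZero n}} → d ∣ n → d ∈ divisors n
∣⇒∈divisors {zero}  {suc n} 0∣n with () ← 0∣⇒≡0 0∣n
-- `suc d` sits at index `d` of `applyUpTo suc n`, and the required `d < n` unfolds to `suc d ≤ n`.
∣⇒∈divisors {suc d} {n}     d∣n = ∈-filter⁺ (_∣? n) (∈-applyUpTo⁺ suc (∣⇒≤ d∣n)) d∣n

∈divisors⇒∣ : ∀ {d n} → d ∈ divisors n → d ∣ n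
∈divisors⇒∣ {n = n} d∈ = proj₂ (∈-filter⁻ (_∣? n) {xs = applyUpTo suc n} d∈)

-- Write `p * m ≡ c * d`. By Euclid's lemma `p` divides `c` or `d`; cancelling it leaves `m ≡ q * d`
-- in the first case and `m ≡ c * e` in the second.
∣p*m⇒∣m⊎≡p*∣m : ∀ {d p m} → Prime p → d ∣ p * m → d ∣ m ⊎ ∃ λ e → d ≡ p * e × e ∣ m
∣p*m⇒∣m⊎≡p*∣m {d} {p} {m} p-prime (divides c pm≡cd)
  with euclidsLemma c d p-prime (subst (p ∣_) pm≡cd (m∣m*n m))
... | inj₁ (divides-refl q) = inj₁ (divides q (*-cancelˡ-≡ m (q * d) p (trans pm≡cd eq)))
  where
  instance _ = prime⇒nonZero p-prime
  eq : q * p * d ≡ p * (q * d)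
  eq = solve (q ∷ p ∷ d ∷ [])
... | inj₂ (divides-refl e) = inj₂ (e , *-comm e p , divides c (*-cancelˡ-≡ m (c * e) p (trans pm≡cd eq)))
  where
  instance _ = prime⇒nonZero p-prime
  eq : c * (e * p) ≡ p * (c * e)
  eq = solve (c ∷ e ∷ p ∷ [])

-- Induction on `s`: either `d` already divides the smaller power, or one factor 2 can be taken out
-- of `d`.
∣2^s⇒≡2^i : ∀ {d} s → d ∣ 2 ^ s → ∃ λ i → i ≤ s × d ≡ 2 ^ i
∣2^s⇒≡2^i zero d∣1 = 0 , ≤-refl , ∣1⇒≡1 d∣1
∣2^s⇒≡2^i (suc s) d∣ with ∣p*m⇒∣m⊎≡p*∣m prime[2] d∣
... | inj₁ d∣2^s with i , i≤s , d≡ ← ∣2^s⇒≡2^i s d∣2^s = i , m≤n⇒m≤1+n i≤s , d≡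
... | inj₂ (e , d≡2e , e∣2^s) with i , i≤s , e≡ ← ∣2^s⇒≡2^i s e∣2^s =
  suc i , s≤s i≤s , trans d≡2e (cong (2 *_) e≡)

2^i∣2^s : ∀ {i s} → i ≤ s → 2 ^ i ∣ 2 ^ s
2^i∣2^s {i} {s} i≤s = divides (2 ^ (s ∸ i)) (begin
  2 ^ s               ≡⟨ cong (2 ^_) (m∸n+n≡m i≤s) ⟨
  2 ^ (s ∸ i + i)     ≡⟨ ^-distribˡ-+-* 2 (s ∸ i) i ⟩
  2 ^ (s ∸ i) * 2 ^ i ∎)
  where open ≡-Reasoning

-- Otherwise `p` is itself a power of two, hence 1 or even.
oddPrime∤2^s : ∀ {p} s → Prime p → ¬ 2 ∣ p → ¬ p ∣ 2 ^ s
oddPrime∤2^s s p-prime 2∤p p∣2^s with ∣2^s⇒≡2^i s p∣2^s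
... | zero  , _ , refl = ¬prime[1] p-prime
... | suc i , _ , refl = 2∤p (m∣m*n (2 ^ i))

powersOfTwo : ℕ → List ℕ
powersOfTwo = applyUpTo (2 ^_)

powersOfTwo-! : ∀ t → Unique (powersOfTwo t)
powersOfTwo-! t = Unique.applyUpTo⁺₁ (2 ^_) t (λ i<j _ → <⇒≢ (^-monoʳ-< 2 ≤-refl i<j))

sum-powersOfTwo : ∀ t → suc (sum (powersOfTwo t)) ≡ 2 ^ t
sum-powersOfTwo zero    = refl
sum-powersOfTwo (suc t) = begin
  suc (sum (powersOfTwo (suc t)))           ≡⟨ cong (suc ∘ sum) (applyUpTo-∷ʳ (2 ^_) t) ⟨
  suc (sum (powersOfTwo t ∷ʳ 2 ^ t))        ≡⟨ cong suc (sum-++ (powersOfTwo t) _) ⟩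
  suc (sum (powersOfTwo t)) + (2 ^ t + 0)   ≡⟨ cong (_+ (2 ^ t + 0)) (sum-powersOfTwo t) ⟩
  -- `2 ^ suc t` unfolds to `2 ^ t + (2 ^ t + 0)`, the `+ 0` matching the end of the one-element
  -- sum.
  2 ^ suc t                                 ∎
  where open ≡-Reasoning

-- Both lists are repetition-free, so comparing members suffices. Oddness of `p` keeps the two
-- halves disjoint: a common entry `2 ^ i ≡ p * e` would make `p` divide a power of two.
divisors-2^s*p : ∀ {p} s → Prime p → ¬ 2 ∣ p →
  divisors (2 ^ s * p) ↭ powersOfTwo (suc s) ++ map (p *_) (powersOfTwo (suc s))
divisors-2^s*p {p} s p-prime 2∤p =
  unique∧⊆∧⊇⇒↭ (divisors-! (2 ^ s * p))
    (Unique.++⁺ (powersOfTwo-! _) (Unique.map⁺ (*-cancelˡ-≡ _ _ p) (powersOfTwo-! _)) disjoint)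
    (to ∘ ∈divisors⇒∣ {n = 2 ^ s * p}) (∣⇒∈divisors ∘ from ∘ ∈-++⁻ (powersOfTwo (suc s)))
  where
  instance
    _ = prime⇒nonZero p-prime
    _ = m^n≢0 2 s
    _ = m*n≢0 (2 ^ s) p

  powers : List ℕ
  powers = powersOfTwo (suc s)

  disjoint : ∀ {d} → ¬ (d ∈ powers × d ∈ map (p *_) powers)
  disjoint (d∈ , d∈′)
    with i , _ , refl ← ∈-applyUpTo⁻ (2 ^_) d∈
    with e , _ , 2^i≡p*e ← ∈-map⁻ (p *_) d∈′
    = oddPrime∤2^s i p-prime 2∤p (subst (p ∣_) (sym 2^i≡p*e) (m∣m*n e))

  ∣2^s⇒∈ : ∀ {d} → d ∣ 2 ^ s → d ∈ powers
  ∣2^s⇒∈ d∣ with i , i≤s , refl ← ∣2^s⇒≡2^i s d∣ = ∈-applyUpTo⁺ (2 ^_) (s≤s i≤s)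

  ∈⇒∣2^s : ∀ {d} → d ∈ powers → d ∣ 2 ^ s
  ∈⇒∣2^s d∈ with i , i<1+s , refl ← ∈-applyUpTo⁻ (2 ^_) d∈ = 2^i∣2^s (s≤s⁻¹ i<1+s)

  to : ∀ {d} → d ∣ 2 ^ s * p → d ∈ powers ++ map (p *_) powers
  to {d} d∣ with ∣p*m⇒∣m⊎≡p*∣m p-prime (subst (d ∣_) (*-comm (2 ^ s) p) d∣)
  ... | inj₁ d∣2^s              = ∈-++⁺ˡ (∣2^s⇒∈ d∣2^s)
  ... | inj₂ (e , refl , e∣2^s) = ∈-++⁺ʳ powers (∈-map⁺ (p *_) (∣2^s⇒∈ e∣2^s))

  from : ∀ {d} → d ∈ powers ⊎ d ∈ map (p *_) powers → d ∣ 2 ^ s * p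
  from (inj₁ d∈) = ∣m⇒∣m*n p (∈⇒∣2^s d∈)
  from (inj₂ d∈) with e , e∈ , refl ← ∈-map⁻ (p *_) d∈ =
    subst (p * e ∣_) (*-comm p (2 ^ s)) (*-monoʳ-∣ p (∈⇒∣2^s e∈))

sum-divisors-2^s*p : ∀ {p} s → Prime p → ¬ 2 ∣ p →
  sum (divisors (2 ^ s * p)) ≡ sum (powersOfTwo (suc s)) * suc p
sum-divisors-2^s*p {p} s p-prime 2∤p = begin
  sum (divisors (2 ^ s * p))           ≡⟨ sum-↭ (divisors-2^s*p s p-prime 2∤p) ⟩
  sum (powers ++ map (p *_) powers)    ≡⟨ sum-++ powers _ ⟩
  sum powers + sum (map (p *_) powers) ≡⟨ cong (sum powers +_) (sum-map-* p powers) ⟩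
  sum powers + p * sum powers          ≡⟨ *-comm (suc p) (sum powers) ⟩
  sum powers * suc p                   ∎
  where
  open ≡-Reasoning
  powers = powersOfTwo (suc s)

-- The hypothesis on the sum is σ(n) - 2n = d without subtraction, its terms ordered as they are
-- removed: `n`, then `d`, so that cancelling both leaves `n` for the remaining divisors.
nearPerfect : ∀ {n d} .{{_ : NonZero n}} → d ∣ n → d ≢ n → sum (divisors n) ≡ n + (d + n) →
              NearPerfectWithRedundantDivisor n d
nearPerfect {n} {d} d∣n d≢n σ≡ = record
  { nonZero        = ≢-nonZero (≢-nonZero⁻¹ n)
  ; properDivisor  = d∈proper
  ; sumOfTheOthers = sym (+-cancelˡ-≡ d _ _ (+-cancelˡ-≡ n _ _ (trans (sym removed) σ≡)))
  }
  where
  d∈proper : d ∈ properDivisors n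
  d∈proper = ∈-filter⁺ (λ e → ¬? (e ≟ n)) (∣⇒∈divisors d∣n) d≢n

  removed : sum (divisors n) ≡ n + (d + sum (filter (λ e → ¬? (e ≟ d)) (properDivisors n)))
  removed = trans (sum-↭ (∈⇒↭∷filter (divisors-! n) (∣⇒∈divisors ∣-refl)))
    (cong (n +_) (sum-↭ (∈⇒↭∷filter (Unique.filter⁺ (λ e → ¬? (e ≟ n)) (divisors-! n)) d∈proper)))

-- Primality rules out truncation: if `a ≤ b`, the difference would be 0, which is not prime.
∸-prime⇒+ : ∀ a b → Prime (a ∸ b ∸ 1) → suc (a ∸ b ∸ 1) + b ≡ a
∸-prime⇒+ a b p-prime with a ∸ b in eq
... | zero  = contradiction p-prime ¬prime[0]
... | suc p = trans (cong (_+ b) (sym eq)) (m∸n+n≡m {a} {b} (<⇒≤ b<a))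
  where
  b<a : b < a
  b<a = m∸n≢0⇒n<m (1+n≢0 ∘ trans (sym eq))

theorem3 : (k t : ℕ) → k ≥ 1 → t ≥ k + 1 →
    Prime (2 ^ t ∸ 2 ^ k ∸ 1) →
    NearPerfectWithRedundantDivisor (2 ^ (t ∸ 1) * (2 ^ t ∸ 2 ^ k ∸ 1)) (2 ^ k)
theorem3 (suc j) (suc s) _ (s≤s k≤s) p-prime = nearPerfect 2^k∣n 2^k≢n σ≡
  where
  open ≡-Reasoning
  k = suc j
  p = 2 ^ suc s ∸ 2 ^ k ∸ 1
  S = sum (powersOfTwo (suc s))

  instance
    _ = prime⇒nonZero p-prime
    _ = m^n≢0 2 s
    _ = m*n≢0 (2 ^ s) p

  1+p+2^k≡2^t : suc p + 2 ^ k ≡ 2 ^ suc s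
  1+p+2^k≡2^t = ∸-prime⇒+ (2 ^ suc s) (2 ^ k) p-prime

  -- In `p + 2 ^ k + 1 ≡ 2 ^ suc s` both powers are even, the first because `k` is `suc j`; an even
  -- `p` would force 2 to divide 1.
  2∤p : ¬ 2 ∣ p
  2∤p 2∣p = contradiction (∣1⇒≡1 2∣1) λ ()
    where
    2∣1 : 2 ∣ 1
    2∣1 = ∣m+n∣m⇒∣n {m = p + 2 ^ k}
      (subst (2 ∣_) (trans (sym 1+p+2^k≡2^t) (+-comm 1 (p + 2 ^ k))) (m∣m*n (2 ^ s)))
      (∣m∣n⇒∣m+n 2∣p (m∣m*n (2 ^ j)))

  2^k∣n : 2 ^ k ∣ 2 ^ s * p
  -- After the match on `s≤s`, the bound `k≤s` reads `j + 1 ≤ s`, hence the commutation.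
  2^k∣n = ∣m⇒∣m*n p (2^i∣2^s (subst (_≤ s) (+-comm j 1) k≤s))

  -- The odd prime `p` divides the right side but no power of two.
  2^k≢n : 2 ^ k ≢ 2 ^ s * p
  2^k≢n 2^k≡n = oddPrime∤2^s k p-prime 2∤p (subst (p ∣_) (sym 2^k≡n) (n∣m*n (2 ^ s)))

  S≡p+2^k : S ≡ p + 2 ^ k
  S≡p+2^k = suc-injective (trans (sum-powersOfTwo (suc s)) (sym 1+p+2^k≡2^t))

  -- Exposes the factor `suc p + d`, which at `d = 2 ^ k` equals `2 ^ suc s`.
  expand : ∀ p d → (p + d) * suc p ≡ (suc p + d) * p + d
  expand p d = solve (p ∷ d ∷ [])

  collect : ∀ a p d → 2 * a * p + d ≡ a * p + (d + a * p)
  collect a p d = solve (a ∷ p ∷ d ∷ [])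

  σ≡ : sum (divisors (2 ^ s * p)) ≡ 2 ^ s * p + (2 ^ k + 2 ^ s * p)
  σ≡ = begin
    sum (divisors (2 ^ s * p))        ≡⟨ sum-divisors-2^s*p s p-prime 2∤p ⟩
    S * suc p                         ≡⟨ cong (_* suc p) S≡p+2^k ⟩
    (p + 2 ^ k) * suc p               ≡⟨ expand p (2 ^ k) ⟩
    (suc p + 2 ^ k) * p + 2 ^ k       ≡⟨ cong (λ a → a * p + 2 ^ k) 1+p+2^k≡2^t ⟩
    2 ^ suc s * p + 2 ^ k             ≡⟨ collect (2 ^ s) p (2 ^ k) ⟩
    2 ^ s * p + (2 ^ k + 2 ^ s * p)   ∎
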